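{- Let $G$ be a linear oriented hypergraph with incidence dual $G^*$. Then the intersection graph of $G$ equals the strict $2$-section of its dual: $\Lambda(G)=\llbracket G^*\rrbracket_2$.
   Context: A hypergraph $H=(V,E,\mathcal I)$ consists of a finite set $V$ of vertices, a finite family $E=(e_\iota)_{\iota\in\Omega}$ of subsets of $V$ (the edges; an edge may be empty, and edges with different indices are regarded as different even if they coincide as sets) and its incidences $\mathcal I$. All hypergraphs are simple: each vertex $v\in e$ is incident with $e$ exactly once, so $\mathcal I=\{(v,e): v\in e\}$. $H$ is linear if $|e\cap f|\le 1$ for any two edges $e,f$ with distinct indices. An oriented hypergraph is a pair $G=(H,\sigma)$ with $\sigma:\mathcal I\to\{+1,-1\}$; hypergraph terminology for $G$ refers to $H$. The incidence dual $G^*$ has vertex set $E$ and edge family $V$, where $e$ is incident with $v$ in $G^*$ iff $v$ is incident with $e$ in $G$; its orientation is $\sigma^*(e,v)=\sigma(v,e)$. The dual of a linear oriented hypergraph is again linear. Intersection graph: for a linear $G$, $\Lambda(G)$ is the oriented hypergraph with vertex set $E(G)$ and one edge $ef=\{e,f\}$ for each pair of distinct $e,f\in E(G)$ with $e\cap f\ne\varnothing$; if $v\in e\cap f$ then $\sigma_{\Lambda(G)}(e,ef)=\sigma_G(v,e)$ and $\sigma_{\Lambda(G)}(f,ef)=\sigma_G(v,f)$. Strict $2$-section: for a linear $G$, $\llbracket G\rrbracket_2$ is the oriented hypergraph with vertex set $V(G)$ and one edge $f$ for each $2$-element set $f\subseteq V(G)$ contained in some (necessarily unique) edge $e$ of $G$;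 its orientation is $\sigma_{\llbracket G\rrbracket_2}(v,f)=\sigma_G(v,e)$ for $v\in f$. Equality of oriented hypergraphs means: same vertex set, and edge families that agree up to a bijective renaming of edges preserving the vertex sets of the edges and the orientation of each incidence. -}

module Defs where

open import Data.Fin.Base using (Fin; _<_)
open import Data.Fin.Properties using (_<?_; _≟_; any?; suc-injective)
open import Data.Fin.Subset using (Subset; ⊥; inside; outside; _∈_; _⊆_; _∩_; _∪_; ⁅_⁆; ∣_∣; Nonempty)
open import Data.Fin.Subset.Properties
  using (nonempty?; _⊆?_; x∈p∩q⁺; x∈p∩q⁻; x∈p∪q⁻; x∈⁅y⁆⇒x≡y; x∈p⇒∣p-x∣<∣p∣; x∈p∧x≢y⇒x∈p-y; p⊆q⇒∣p∣≤∣q∣; ∣⊥∣≡0)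
open import Data.List.Base using (List; []; _∷_; _++_; map; filter; allFin; cartesianProduct; length; lookup)
open import Data.List.Membership.Propositional.Properties using (∈-lookup)
import Data.List.Relation.Unary.All as All
open import Data.List.Relation.Unary.All.Properties using (all-filter)
open import Data.Nat.Base using (ℕ; zero; suc; _≤_; z≤n; s≤s)
import Data.Nat.Properties as ℕ
open import Data.Product.Base using (_×_; _,_; ∃; proj₁; proj₂)
open import Data.Sign.Base using (Sign)
open import Data.Sum.Base using ([_,_]′)
open import Data.Vec.Base as Vec using (tabulate)
open import Data.Vec.Properties using (lookup∘tabulate; []=⇒lookup; lookup⇒[]=)
open import Data.Vec.Properties.WithK using ([]=-irrelevant)
open import Function.Bundles using (_↔_; Inverse)
open import Relation.Binary.PropositionalEquality using (_≡_; _≢_; refl; sym; trans; cong; subst)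
open import Relation.Nullary using (yes; no; contradiction)
open import Relation.Nullary.Decidable using (_×-dec_)
open import Relation.Unary using (Decidable)

private
  variable
    n m m′ : ℕ

-- Vertex set Fin n, edge family indexed by Fin m; distinct indices may carry
-- equal (possibly empty) subsets.
record Hypergraph (n m : ℕ) : Set where
  field
    edge : Fin m → Subset n

-- An incidence is a proof of v ∈ edge e; such proofs are unique
-- ([]=-irrelevant), so σ is a function on incident pairs.
record OrientedHypergraph (n m : ℕ) : Set where
  field
    hypergraph : Hypergraph n m
  open Hypergraph hypergraph public
  field
    σ : ∀ v e → v ∈ edge e → Sign

open OrientedHypergraph

Linear : OrientedHypergraph n m → Set
Linear G = ∀ {e f} → e ≢ f → ∣ edge G e ∩ edge G f ∣ ≤ 1

record _≐_ (G : OrientedHypergraph n m) (G′ : OrientedHypergraph n m′) : Set where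
  field
    rename : Fin m ↔ Fin m′
  open Inverse rename using (to)
  field
    edge-≡ : ∀ e → edge G e ≡ edge G′ (to e)
    σ-≡    : ∀ v e (p : v ∈ edge G e) (q : v ∈ edge G′ (to e)) →
             σ G v e p ≡ σ G′ v (to e) q

infix 4 _≐_

dualEdge : OrientedHypergraph n m → Fin n → Subset m
dualEdge G v = tabulate (λ e → Vec.lookup (edge G e) v)

∈-dualEdge⁻ : ∀ (G : OrientedHypergraph n m) {v e} → e ∈ dualEdge G v → v ∈ edge G e
∈-dualEdge⁻ G {v} {e} p = lookup⇒[]= v (edge G e)
  (trans (sym (lookup∘tabulate (λ e → Vec.lookup (edge G e) v) e)) ([]=⇒lookup p))

∈-dualEdge⁺ : ∀ (G : OrientedHypergraph n m) {v e} → v ∈ edge G e → e ∈ dualEdge G v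
∈-dualEdge⁺ G {v} {e} p = lookup⇒[]= e (dualEdge G v)
  (trans (lookup∘tabulate (λ e → Vec.lookup (edge G e) v) e) ([]=⇒lookup p))

infix 9 _*

_* : OrientedHypergraph n m → OrientedHypergraph m n
G * = record
  { hypergraph = record { edge = dualEdge G }
  ; σ          = λ e v p → σ G v e (∈-dualEdge⁻ G p)
  }

-- The condition e < f picks one representative (e , f) of each unordered
-- pair {e , f} of distinct edges.
Meet : OrientedHypergraph n m → Fin m × Fin m → Set
Meet G (e , f) = e < f × Nonempty (edge G e ∩ edge G f)

meet? : (G : OrientedHypergraph n m) → Decidable (Meet G)
meet? G (e , f) = (e <? f) ×-dec nonempty? (edge G e ∩ edge G f)

meetingPairs : OrientedHypergraph n m → List (Fin m × Fin m)
meetingPairs {m = m} G = filter (meet? G) (cartesianProduct (allFin m) (allFin m))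

meets : (G : OrientedHypergraph n m) (i : Fin (length (meetingPairs G))) →
        Meet G (lookup (meetingPairs G) i)
meets {m = m} G i =
  All.lookup (all-filter (meet? G) (cartesianProduct (allFin m) (allFin m)))
             (∈-lookup {xs = meetingPairs G} i)

pair : Fin n × Fin n → Subset n
pair (e , f) = ⁅ e ⁆ ∪ ⁅ f ⁆

∈-pair : ∀ (G : OrientedHypergraph n m) {v x e f} →
         v ∈ edge G e ∩ edge G f → x ∈ pair (e , f) → v ∈ edge G x
∈-pair G {v} {x} {e} {f} v∈ x∈ with x∈p∩q⁻ (edge G e) (edge G f) v∈
... | v∈e , v∈f =
  [ (λ x∈e → subst (λ y → v ∈ edge G y) (sym (x∈⁅y⁆⇒x≡y e x∈e)) v∈e)
  , (λ x∈f → subst (λ y → v ∈ edge G y) (sym (x∈⁅y⁆⇒x≡y f x∈f)) v∈f)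
  ]′ (x∈p∪q⁻ ⁅ e ⁆ ⁅ f ⁆ x∈)

-- The intersection graph. The orientation uses some v ∈ e ∩ f; when G is
-- linear the choice is immaterial (Λ-σ).
Λ : (G : OrientedHypergraph n m) → OrientedHypergraph m (length (meetingPairs G))
Λ G = record
  { hypergraph = record { edge = λ i → pair (lookup (meetingPairs G) i) }
  ; σ          = λ x i x∈ → let v , v∈ = proj₂ (meets G i) in σ G v x (∈-pair G v∈ x∈)
  }

subsets : ∀ n → List (Subset n)
subsets zero    = Vec.[] ∷ []
subsets (suc n) = map (outside Vec.∷_) (subsets n) ++ map (inside Vec.∷_) (subsets n)

SectionEdge : OrientedHypergraph n m → Subset n → Set
SectionEdge G f = ∣ f ∣ ≡ 2 × ∃ λ e → f ⊆ edge G e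

sectionEdge? : (G : OrientedHypergraph n m) → Decidable (SectionEdge G)
sectionEdge? G f = (∣ f ∣ ℕ.≟ 2) ×-dec any? (λ e → f ⊆? edge G e)

sectionEdges : OrientedHypergraph n m → List (Subset n)
sectionEdges {n = n} G = filter (sectionEdge? G) (subsets n)

isSectionEdge : (G : OrientedHypergraph n m) (i : Fin (length (sectionEdges G))) →
                SectionEdge G (lookup (sectionEdges G) i)
isSectionEdge {n = n} G i =
  All.lookup (all-filter (sectionEdge? G) (subsets n)) (∈-lookup {xs = sectionEdges G} i)

-- The strict 2-section. The orientation uses some edge containing f; when G is
-- linear there is only one (⟦⟧₂-σ).
⟦_⟧₂ : (G : OrientedHypergraph n m) → OrientedHypergraph n (length (sectionEdges G))
⟦ G ⟧₂ = record
  { hypergraph = record { edge = lookup (sectionEdges G) }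
  ; σ          = λ v i v∈ → let e , f⊆e = proj₂ (isSectionEdge G i) in σ G v e (f⊆e v∈)
  }

private
  ∣p∣≤1⇒x≡y : ∀ {p : Subset n} {x y} → ∣ p ∣ ≤ 1 → x ∈ p → y ∈ p → x ≡ y
  ∣p∣≤1⇒x≡y {x = x} {y} ∣p∣≤1 x∈p y∈p with x ≟ y
  ... | yes x≡y = x≡y
  ... | no  x≢y = contradiction
    (ℕ.≤-trans (ℕ.≤-trans (s≤s (ℕ.≤-trans (s≤s z≤n) (x∈p⇒∣p-x∣<∣p∣ (x∈p∧x≢y⇒x∈p-y x∈p x≢y))))
      (x∈p⇒∣p-x∣<∣p∣ y∈p)) ∣p∣≤1) λ { (s≤s ()) }

  x≡y⇒∣p∣≤1 : (p : Subset n) → (∀ {x y} → x ∈ p → y ∈ p → x ≡ y) → ∣ p ∣ ≤ 1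
  x≡y⇒∣p∣≤1 Vec.[]               h = z≤n
  x≡y⇒∣p∣≤1 (outside Vec.∷ p)    h =
    x≡y⇒∣p∣≤1 p (λ x∈p y∈p → suc-injective (h (Vec.there x∈p) (Vec.there y∈p)))
  x≡y⇒∣p∣≤1 {suc n} (inside Vec.∷ p) h = s≤s (ℕ.≤-trans
    (p⊆q⇒∣p∣≤∣q∣ {q = ⊥} (λ x∈p → contradiction (h Vec.here (Vec.there x∈p)) λ ()))
    (ℕ.≤-reflexive (∣⊥∣≡0 n)))

  σ-cong : ∀ (G : OrientedHypergraph n m) {v v′ e e′} → v ≡ v′ → e ≡ e′ →
           (p : v ∈ edge G e) (q : v′ ∈ edge G e′) → σ G v e p ≡ σ G v′ e′ q
  σ-cong G refl refl p q = cong (σ G _ _) ([]=-irrelevant p q)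

*-linear : (G : OrientedHypergraph n m) → Linear G → Linear (G *)
*-linear G lin {v} {w} v≢w = x≡y⇒∣p∣≤1 (edge (G *) v ∩ edge (G *) w) unique
  where
  unique : ∀ {e f} → e ∈ edge (G *) v ∩ edge (G *) w → f ∈ edge (G *) v ∩ edge (G *) w → e ≡ f
  unique {e} {f} e∈ f∈ with e ≟ f
  ... | yes e≡f = e≡f
  ... | no  e≢f =
    let v*∋e , w*∋e = x∈p∩q⁻ (dualEdge G v) (dualEdge G w) e∈
        v*∋f , w*∋f = x∈p∩q⁻ (dualEdge G v) (dualEdge G w) f∈
    in contradiction
      (∣p∣≤1⇒x≡y (lin e≢f) (x∈p∩q⁺ (∈-dualEdge⁻ G v*∋e , ∈-dualEdge⁻ G v*∋f))
                           (x∈p∩q⁺ (∈-dualEdge⁻ G w*∋e , ∈-dualEdge⁻ G w*∋f)))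
      v≢w

Λ-σ : (G : OrientedHypergraph n m) → Linear G →
      ∀ i → let e , f = lookup (meetingPairs G) i in
      ∀ {v} → v ∈ edge G e → v ∈ edge G f →
      ∀ x (x∈ : x ∈ edge (Λ G) i) (v∈x : v ∈ edge G x) → σ (Λ G) x i x∈ ≡ σ G v x v∈x
Λ-σ G lin i v∈e v∈f x x∈ v∈x with lookup (meetingPairs G) i | meets G i
... | e , f | e<f , w , w∈ =
  σ-cong G (∣p∣≤1⇒x≡y (lin (λ { refl → ℕ.<-irrefl refl e<f })) w∈ (x∈p∩q⁺ (v∈e , v∈f)))
         refl (∈-pair G w∈ x∈) v∈x

⟦⟧₂-σ : (G : OrientedHypergraph n m) → Linear G →
        ∀ i {e} (f⊆e : edge ⟦ G ⟧₂ i ⊆ edge G e) →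
        ∀ v (v∈ : v ∈ edge ⟦ G ⟧₂ i) → σ ⟦ G ⟧₂ v i v∈ ≡ σ G v e (f⊆e v∈)
⟦⟧₂-σ G lin i {e} f⊆e v v∈ with isSectionEdge G i
... | ∣f∣≡2 , e′ , f⊆e′ with e′ ≟ e
...   | yes e′≡e = σ-cong G refl e′≡e (f⊆e′ v∈) (f⊆e v∈)
...   | no  e′≢e = contradiction
  (subst (_≤ 1) ∣f∣≡2
    (ℕ.≤-trans (p⊆q⇒∣p∣≤∣q∣ (λ x∈ → x∈p∩q⁺ (f⊆e′ x∈ , f⊆e x∈))) (lin e′≢e)))
  λ { (s≤s ()) }

{-# OPTIONS --safe #-}
module Submission where

-- A 2-element set {e , f} of edges lies in the dual edge v* = {e : v ∈ e}
-- exactly when v ∈ e ∩ f, so both hypergraphs have as edges the pairs of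
-- distinct intersecting edges of G, each occurring once, and both orient the
-- incidence of e with {e , f} by σ(v , e).

open import Defs
open import Data.Fin.Base using (Fin; zero; suc; _<_)
open import Data.Fin.Properties using (<-irrefl; <-asym)
open import Data.Fin.Subset using (Subset; ⊥; inside; outside; _∈_; _⊆_; ⁅_⁆; ∣_∣)
open import Data.Fin.Subset.Properties
  using (∪-identityˡ; ∣⁅x⁆∣≡1; x∈p∩q⁺; x∈p∩q⁻; x∈p∪q⁺; x∈p∪q⁻; x∈⁅x⁆; x∈⁅y⁆⇒x≡y)
open import Data.List.Base using (List; []; _∷_; lookup; allFin; map)
import Data.List.Membership.Propositional as List
open import Data.List.Membership.Propositional.Properties
  using (∈-lookup; ∈-map⁺; ∈-map⁻; ∈-++⁺ˡ; ∈-++⁺ʳ; ∈-filter⁺; ∈-cartesianProduct⁺; ∈-allFin)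
import Data.List.Relation.Unary.All as All
open import Data.List.Relation.Unary.AllPairs using ([]; _∷_)
open import Data.List.Relation.Unary.Any using (index; here)
open import Data.List.Relation.Unary.Any.Properties using (lookup-index)
open import Data.List.Relation.Unary.Unique.Propositional using (Unique)
open import Data.List.Relation.Unary.Unique.Propositional.Properties
  using (map⁺; ++⁺; filter⁺; cartesianProduct⁺; allFin⁺)
open import Data.Nat.Base using (ℕ; zero; suc; s≤s; z≤n; s<s⁻¹)
open import Data.Nat.Properties using (suc-injective)
open import Data.Product.Base using (_×_; _,_; ∃; proj₁; proj₂)
open import Data.Sum.Base using (inj₁; inj₂)
import Data.Vec.Base as Vec
open import Data.Vec.Properties using (∷-injectiveʳ)
open import Function.Bundles using (_↔_; mk↔ₛ′)
open import Function.Definitions using (Injective)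
open import Relation.Binary.PropositionalEquality
  using (_≡_; refl; sym; trans; cong; cong₂; subst)
open import Relation.Nullary using (contradiction)

open OrientedHypergraph

private
  variable
    n m k l : ℕ
    A : Set

lookup-injective : {xs : List A} → Unique xs → Injective _≡_ _≡_ (lookup xs)
lookup-injective (_ ∷ _)  {zero}  {zero}  _  = refl
lookup-injective (x∉ ∷ _) {zero}  {suc j} eq = contradiction eq (All.lookup x∉ (∈-lookup j))
lookup-injective (x∉ ∷ _) {suc i} {zero}  eq = contradiction (sym eq) (All.lookup x∉ (∈-lookup i))
lookup-injective (_ ∷ u)  {suc i} {suc j} eq = cong suc (lookup-injective u eq)

-- Going across and back preserves the value in `A`, so injectivity returns the original index. This
-- reduces the renaming of edges to a comparison of edges as sets, once neither family repeats one.
sameImage⇒↔ : {f : Fin k → A} {g : Fin l → A} →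
              Injective _≡_ _≡_ f → Injective _≡_ _≡_ g →
              (∀ i → ∃ λ j → f i ≡ g j) → (∀ j → ∃ λ i → g j ≡ f i) →
              Fin k ↔ Fin l
sameImage⇒↔ f-inj g-inj f⊆g g⊆f = mk↔ₛ′ (λ i → proj₁ (f⊆g i)) (λ j → proj₁ (g⊆f j))
  (λ j → g-inj (sym (trans (proj₂ (g⊆f j)) (proj₂ (f⊆g _)))))
  (λ i → f-inj (sym (trans (proj₂ (f⊆g i)) (proj₂ (g⊆f _)))))

∈-subsets : (p : Subset n) → p List.∈ subsets n
∈-subsets Vec.[]                   = here refl
∈-subsets (outside Vec.∷ p)        = ∈-++⁺ˡ (∈-map⁺ (outside Vec.∷_) (∈-subsets p))
∈-subsets {suc n} (inside Vec.∷ p) =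
  ∈-++⁺ʳ (map (outside Vec.∷_) (subsets n)) (∈-map⁺ (inside Vec.∷_) (∈-subsets p))

subsets-unique : ∀ n → Unique (subsets n)
subsets-unique zero    = All.[] ∷ []
subsets-unique (suc n) =
  ++⁺ (map⁺ ∷-injectiveʳ (subsets-unique n)) (map⁺ ∷-injectiveʳ (subsets-unique n)) disjoint
  where
  disjoint : ∀ {p} → p List.∈ map (outside Vec.∷_) (subsets n) ×
                     p List.∈ map (inside Vec.∷_) (subsets n) → _
  disjoint (p∈ , p∈′) with ∈-map⁻ _ p∈ | ∈-map⁻ _ p∈′
  ... | _ , _ , refl | _ , _ , ()

x∈pair : (x y : Fin n) → x ∈ pair (x , y)
x∈pair x y = x∈p∪q⁺ (inj₁ (x∈⁅x⁆ x))

y∈pair : (x y : Fin n) → y ∈ pair (x , y)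
y∈pair x y = x∈p∪q⁺ (inj₂ (x∈⁅x⁆ y))

-- The order settles which element is which: `x` and `y` in the same singleton would contradict
-- `x < y`, and a crossed matching would turn `x′ < y′` into `y < x`.
pair-injective : {x y x′ y′ : Fin n} → x < y → x′ < y′ →
                 pair (x , y) ≡ pair (x′ , y′) → (x , y) ≡ (x′ , y′)
pair-injective {x = x} {y} {x′} {y′} x<y x′<y′ eq
  with x∈p∪q⁻ ⁅ x′ ⁆ ⁅ y′ ⁆ (subst (x ∈_) eq (x∈pair x y))
     | x∈p∪q⁻ ⁅ x′ ⁆ ⁅ y′ ⁆ (subst (y ∈_) eq (y∈pair x y))
... | inj₁ x∈ | inj₂ y∈ = cong₂ _,_ (x∈⁅y⁆⇒x≡y x′ x∈) (x∈⁅y⁆⇒x≡y y′ y∈)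
... | inj₁ x∈ | inj₁ y∈ =
  contradiction x<y (<-irrefl (trans (x∈⁅y⁆⇒x≡y x′ x∈) (sym (x∈⁅y⁆⇒x≡y x′ y∈))))
... | inj₂ x∈ | inj₂ y∈ =
  contradiction x<y (<-irrefl (trans (x∈⁅y⁆⇒x≡y y′ x∈) (sym (x∈⁅y⁆⇒x≡y y′ y∈))))
... | inj₂ x∈ | inj₁ y∈ with x∈⁅y⁆⇒x≡y y′ x∈ | x∈⁅y⁆⇒x≡y x′ y∈
...   | refl | refl = contradiction x′<y′ (<-asym x<y)

∣pair∣≡2 : {x y : Fin n} → x < y → ∣ pair (x , y) ∣ ≡ 2
∣pair∣≡2 {x = zero}  {suc y} _   =
  -- Once `zero` is split off, the tail of the union is `⊥ ∪ ⁅ y ⁆`.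
  cong suc (trans (cong ∣_∣ (∪-identityˡ ⁅ y ⁆)) (∣⁅x⁆∣≡1 y))
∣pair∣≡2 {x = suc x} {suc y} x<y = ∣pair∣≡2 (s<s⁻¹ x<y)

∣p∣≡0⇒p≡⊥ : (p : Subset n) → ∣ p ∣ ≡ 0 → p ≡ ⊥
∣p∣≡0⇒p≡⊥ Vec.[]            _  = refl
∣p∣≡0⇒p≡⊥ (outside Vec.∷ p) eq = cong (outside Vec.∷_) (∣p∣≡0⇒p≡⊥ p eq)

∣p∣≡1⇒p≡⁅x⁆ : (p : Subset n) → ∣ p ∣ ≡ 1 → ∃ λ x → p ≡ ⁅ x ⁆
∣p∣≡1⇒p≡⁅x⁆ (outside Vec.∷ p) eq with ∣p∣≡1⇒p≡⁅x⁆ p eq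
... | x , p≡ = suc x , cong (outside Vec.∷_) p≡
∣p∣≡1⇒p≡⁅x⁆ (inside Vec.∷ p)  eq =
  zero , cong (inside Vec.∷_) (∣p∣≡0⇒p≡⊥ p (suc-injective eq))

-- The first `inside` entry gives the smaller element and the rest of the vector the larger one, so
-- the pair comes out increasing, as `Meet` demands.
∣p∣≡2⇒p≡pair : (p : Subset n) → ∣ p ∣ ≡ 2 → ∃ λ x → ∃ λ y → x < y × p ≡ pair (x , y)
∣p∣≡2⇒p≡pair (outside Vec.∷ p) eq with ∣p∣≡2⇒p≡pair p eq
... | x , y , x<y , p≡ = suc x , suc y , s≤s x<y , cong (outside Vec.∷_) p≡
∣p∣≡2⇒p≡pair (inside Vec.∷ p)  eq with ∣p∣≡1⇒p≡⁅x⁆ p (suc-injective eq)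
... | y , p≡ =
  zero , suc y , s≤s z≤n , cong (inside Vec.∷_) (trans p≡ (sym (∪-identityˡ ⁅ y ⁆)))

module _ (G : OrientedHypergraph n m) where

  -- `meetingPairs` filters a product of repetition-free lists, and its members are increasing
  -- pairs, which can be recovered from their underlying sets.
  Λ-edge-injective : Injective _≡_ _≡_ (edge (Λ G))
  Λ-edge-injective {i} {j} eq = lookup-injective
    (filter⁺ (meet? G) (cartesianProduct⁺ (allFin⁺ m) (allFin⁺ m)))
    (pair-injective (proj₁ (meets G i)) (proj₁ (meets G j)) eq)

  Λ-edge-surjective : ∀ {e f v} → e < f → v ∈ edge G e → v ∈ edge G f →
                      ∃ λ i → pair (e , f) ≡ edge (Λ G) i
  Λ-edge-surjective {e} {f} {v} e<f v∈e v∈f = index ef∈ , cong pair (lookup-index ef∈)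
    where
    ef∈ : (e , f) List.∈ meetingPairs G
    ef∈ = ∈-filter⁺ (meet? G) (∈-cartesianProduct⁺ (∈-allFin e) (∈-allFin f))
                    (e<f , v , x∈p∩q⁺ (v∈e , v∈f))

  ⟦⟧₂-edge-injective : Injective _≡_ _≡_ (edge ⟦ G ⟧₂)
  ⟦⟧₂-edge-injective = lookup-injective (filter⁺ (sectionEdge? G) (subsets-unique n))

  ⟦⟧₂-edge-surjective : ∀ {f} → SectionEdge G f → ∃ λ i → f ≡ edge ⟦ G ⟧₂ i
  ⟦⟧₂-edge-surjective {f} s = index f∈ , lookup-index f∈
    where
    f∈ : f List.∈ sectionEdges G
    f∈ = ∈-filter⁺ (sectionEdge? G) (∈-subsets f) s

module _ (G : OrientedHypergraph n m) where

  -- The vertex is the witness that the two edges meet; it lies in both, so both belong to its dual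
  -- edge.
  Λ-edge⊆dualEdge : ∀ i → edge (Λ G) i ⊆ dualEdge G (proj₁ (proj₂ (meets G i)))
  Λ-edge⊆dualEdge i x∈ = ∈-dualEdge⁺ G (∈-pair G (proj₂ (proj₂ (meets G i))) x∈)

  Λ-edge⇒⟦*⟧₂-edge : ∀ i → ∃ λ j → edge (Λ G) i ≡ edge ⟦ G * ⟧₂ j
  Λ-edge⇒⟦*⟧₂-edge i = ⟦⟧₂-edge-surjective (G *)
    (∣pair∣≡2 (proj₁ (meets G i)) , _ , Λ-edge⊆dualEdge i)

  ⟦*⟧₂-edge⇒Λ-edge : ∀ j → ∃ λ i → edge ⟦ G * ⟧₂ j ≡ edge (Λ G) i
  ⟦*⟧₂-edge⇒Λ-edge j =
    let ∣p∣≡2 , v , p⊆v*    = isSectionEdge (G *) j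
        e , f , e<f , p≡ef = ∣p∣≡2⇒p≡pair _ ∣p∣≡2
        -- Read back in `G`, this inclusion says that `v` lies in both `e` and `f`, so `v` witnesses
        -- that they meet.
        ef⊆v*              = subst (_⊆ dualEdge G v) p≡ef p⊆v*
        i , ef≡            = Λ-edge-surjective G e<f
                               (∈-dualEdge⁻ G (ef⊆v* (x∈pair e f)))
                               (∈-dualEdge⁻ G (ef⊆v* (y∈pair e f)))
    in i , trans p≡ef ef≡

theorem3p1 : ∀ {n m : ℕ} (G : OrientedHypergraph n m) → Linear G → Λ G ≐ ⟦ G * ⟧₂
theorem3p1 G lin = record
  { rename = sameImage⇒↔ (Λ-edge-injective G) (⟦⟧₂-edge-injective (G *))
                         (Λ-edge⇒⟦*⟧₂-edge G) (⟦*⟧₂-edge⇒Λ-edge G)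
  -- `to i` computes to the first component of this same witness.
  ; edge-≡ = λ i → proj₂ (Λ-edge⇒⟦*⟧₂-edge G i)
  ; σ-≡    = λ x i x∈ x∈′ →
      let j , edge≡ = Λ-edge⇒⟦*⟧₂-edge G i
          _ , v , v∈ = meets G i
          v∈e , v∈f = x∈p∩q⁻ _ _ v∈
          -- The renamed edge also lies in the dual edge of `v`, so linearity of the dual lets `v`
          -- replace whichever containing edge `isSectionEdge` found.
          f⊆v* = λ {y} y∈ → Λ-edge⊆dualEdge G i (subst (y ∈_) (sym edge≡) y∈)
      -- Both sides equal `σ G v x`. The incidence proof is the one to which the orientation of
      -- `G *` unfolds, so the two halves meet definitionally.
      in trans (Λ-σ G lin i v∈e v∈f x x∈ (∈-dualEdge⁻ G (f⊆v* x∈′)))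
               (sym (⟦⟧₂-σ (G *) (*-linear G lin) j f⊆v* x x∈′))
  }
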